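{- Let $\mathcal{A}$ be a finite alphabet. Any episturmian word $\mathbf{t}\in\mathcal{A}^\omega$ has a spinned directive word (an infinite word over $\mathcal{A}\cup\bar{\mathcal{A}}$ directing $\mathbf{t}$) containing infinitely many $L$-spinned letters, but no factor in $\bigcup_{a\in\mathcal{A}}\bar{a}\,\bar{\mathcal{A}}^*a$. Such a directive word is unique if $\mathbf{t}$ is aperiodic.
   Context: Words. $\mathcal{A}^*$ and $\mathcal{A}^\omega$ denote the sets of finite and of right-infinite words over the finite alphabet $\mathcal{A}$. A factor of a word is a finite block of consecutive letters of it. An infinite word is recurrent if each of its factors occurs infinitely often in it. It is aperiodic if it is not ultimately periodic, i.e. not of the form $uv^\omega=uvvv\cdots$ with $u,v$ finite words and $v$ non-empty. Episturmian words. A factor $u$ of an infinite word $\mathbf{w}$ is right special if $ua$ and $ub$ are factors of $\mathbf{w}$ for two distinct letters $a,b$. An infinite word $\mathbf{t}\in\mathcal{A}^\omega$ is episturmian if its set of factors is closed under reversal (mirror image) and $\mathbf{t}$ has at most one right special factor of each length. Spinned words. $\bar{\mathcal{A}}=\{\bar{x}\mid x\in\mathcal{A}\}$ is a disjoint copy of $\mathcal{A}$. Letters of $\mathcal{A}$ are called $L$-spinned, letters of $\bar{\mathcal{A}}$ are called $R$-spinned. A finite or infinite word over $\mathcal{A}\cup\bar{\mathcal{A}}$ is called a spinned word. $\bar{a}\,\bar{\mathcal{A}}^*a$ is the set of finite spinned words $\bar{a}\,u\,a$ with $u$ a (possibly empty) finite word over $\bar{\mathcal{A}}$. Morphisms and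 directive words. For $a\in\mathcal{A}$, $L_a$ and $R_a$ are the morphisms of $\mathcal{A}^*$ (extended letterwise to infinite words) given by $L_a(a)=R_a(a)=a$ and, for $b\ne a$, $L_a(b)=ab$, $R_a(b)=ba$. Put $\mu_a=L_a$ and $\mu_{\bar{a}}=R_a$. A spinned infinite word $\Delta=\breve{x}_1\breve{x}_2\breve{x}_3\cdots$ (with $\breve{x}_n\in\mathcal{A}\cup\bar{\mathcal{A}}$) directs, or is a (spinned) directive word of, the episturmian word $\mathbf{t}$ if there is a sequence $(\mathbf{t}^{(n)})_{n\ge0}$ of recurrent infinite words over $\mathcal{A}$ with $\mathbf{t}^{(0)}=\mathbf{t}$ and $\mathbf{t}^{(n-1)}=\mu_{\breve{x}_n}(\mathbf{t}^{(n)})$ for all $n\ge1$. -}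

module Defs where

open import Data.Fin.Base using (Fin)
open import Data.Fin.Properties using (_≟_)
open import Data.List.Base
  using (List; []; _∷_; _++_; _∷ʳ_; length; lookup; map; reverse; applyUpTo)
open import Data.List.NonEmpty.Base using (List⁺; _∷_; [_])
open import Data.Nat.Base using (ℕ; zero; suc; _+_; _≤_)
open import Data.Nat.DivMod using (_mod_)
open import Data.Product.Base using (∃; ∃₂; ∃-syntax; _×_)
open import Function.Base using (_∘_)
open import Relation.Binary.PropositionalEquality using (_≡_; _≢_; _≗_)
open import Relation.Nullary.Decidable.Core using (yes; no)
open import Relation.Nullary.Negation.Core using (¬_)

-- Right-infinite words are compared with pointwise equality _≗_.
Word : Set → Set
Word A = ℕ → A

private variable
  A B : Set
  k : ℕ

OccursAt : List A → Word A → ℕ → Set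
OccursAt u w i = applyUpTo (λ j → w (i + j)) (length u) ≡ u

Factor : List A → Word A → Set
Factor u w = ∃ (OccursAt u w)

Recurrent : Word A → Set
Recurrent w = ∀ u → Factor u w → ∀ N → ∃[ i ] N ≤ i × OccursAt u w i

infixr 5 _⧺_
_⧺_ : List A → Word A → Word A
([]      ⧺ w) n       = w n
((x ∷ u) ⧺ w) zero    = x
((x ∷ u) ⧺ w) (suc n) = (u ⧺ w) n

infix 8 _^ω
_^ω : List⁺ A → Word A
((x ∷ xs) ^ω) n = lookup (x ∷ xs) (n mod suc (length xs))

UltimatelyPeriodic : Word A → Set
UltimatelyPeriodic {A} w = ∃₂ λ (u : List A) (v : List⁺ A) → w ≗ u ⧺ v ^ω

Aperiodic : Word A → Set
Aperiodic w = ¬ UltimatelyPeriodic w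

RightSpecial : List A → Word A → Set
RightSpecial u w = ∃₂ λ a b → a ≢ b × Factor (u ∷ʳ a) w × Factor (u ∷ʳ b) w

record Episturmian (t : Word A) : Set where
  field
    reversal-closed : ∀ u → Factor u t → Factor (reverse u) t
    right-special-unique : ∀ u v → length u ≡ length v →
      RightSpecial u t → RightSpecial v t → u ≡ v

-- A non-erasing morphism is given by the non-empty images of the letters.
-- emit σ v s is the infinite word v σ(s 0) σ(s 1) σ(s 2) ⋯
emit : (A → List⁺ B) → List⁺ B → Word A → Word B
emit σ (x ∷ _)      s zero    = x
emit σ (x ∷ [])     s (suc n) = emit σ (σ (s 0)) (s ∘ suc) n
emit σ (x ∷ y ∷ ys) s (suc n) = emit σ (y ∷ ys) s n

extend : (A → List⁺ B) → Word A → Word B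
extend σ s = emit σ (σ (s 0)) (s ∘ suc)

-- L a is the letter a itself, R a is the barred letter ā.
data Spinned (A : Set) : Set where
  L R : A → Spinned A

μ : Spinned (Fin k) → Fin k → List⁺ (Fin k)
μ (L a) b with b ≟ a
... | yes _ = [ a ]
... | no  _ = a ∷ b ∷ []
μ (R a) b with b ≟ a
... | yes _ = [ a ]
... | no  _ = b ∷ a ∷ []

-- Δ n is the (n+1)-st letter of the directive word, so it links the words
-- of index n and n + 1.
Directs : Word (Spinned (Fin k)) → Word (Fin k) → Set
Directs {k} Δ t = ∃ λ (ts : ℕ → Word (Fin k)) →
    (∀ n → Recurrent (ts n))
  × ts 0 ≗ t
  × (∀ n → ts n ≗ extend (μ (Δ n)) (ts (suc n)))

InfinitelyManyL : Word (Spinned A) → Set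
InfinitelyManyL Δ = ∀ N → ∃[ n ] N ≤ n × ∃[ a ] Δ n ≡ L a

-- No factor in the union over all letters a of ā Ā* a.
AvoidsBarBlocks : Word (Spinned A) → Set
AvoidsBarBlocks {A} Δ =
  ∀ (a : A) (u : List A) → ¬ Factor (R a ∷ map R u ++ L a ∷ []) Δ

record NormalizedDirective (Δ : Word (Spinned (Fin k))) (t : Word (Fin k)) : Set where
  field
    directs           : Directs Δ t
    infinitely-many-L : InfinitelyManyL Δ
    avoids            : AvoidsBarBlocks Δ

{-# OPTIONS --safe #-}
module Submission where

-- An episturmian word t has a separating letter a, i.e. one occurring in every factor of
-- length 2. If t starts with a, then t = L a (s), otherwise a t = L a (s) and t = R a (s);
-- in both cases s is again episturmian, because an occurrence of a in L a (s) is exactly the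
-- start of a block. Using an L-spin whenever possible produces the normalized directive
-- word: R-spins keep the first letter f and are then never R f, so no block from ā to a
-- arises, and they shorten the first return to f, so they cannot go on forever.
-- Conversely every normalized directive word makes these greedy choices, and the
-- separating letter is unique unless the word is periodic.

open import Defs
open import Axiom.ExcludedMiddle using (ExcludedMiddle)
open import Data.Empty using (⊥-elim)
open import Data.Fin.Base using (Fin; toℕ)
open import Data.Fin.Properties using (_≟_; toℕ-fromℕ<)
open import Data.List.Base
  using (List; []; _∷_; _++_; _∷ʳ_; length; lookup; map; reverse; applyUpTo; applyDownFrom)
open import Data.List.NonEmpty.Base as List⁺ using (_∷_)
open import Data.List.Properties
  using ( ∷-injectiveˡ; ∷-injectiveʳ; length-applyUpTo; length-applyDownFrom
        ; lookup-applyUpTo; applyUpTo-∷ʳ; reverse-applyUpTo)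
open import Data.Nat.Base using (ℕ; zero; suc; _+_; _*_; _∸_; _≤_; _<_; z≤n; s≤s)
open import Data.Nat.DivMod using (_mod_; _%_; _/_; m%n<n; m≡m%n+[m/n]*n)
open import Data.Nat.Properties hiding (_≟_)
open import Data.Product.Base using (∃; ∃-syntax; _×_; _,_; proj₁; proj₂)
open import Data.Sum.Base using (_⊎_; inj₁; inj₂)
open import Function.Base using (_∘_)
open import Level using (0ℓ)
open import Relation.Binary.PropositionalEquality
  using (_≡_; _≢_; _≗_; refl; sym; trans; cong; cong₂; subst; module ≡-Reasoning)
open import Relation.Nullary.Decidable.Core using (yes; no)
open import Relation.Nullary.Negation.Core using (¬_)

private variable
  A : Set
  k : ℕ

-- Windows of infinite words

drop : ℕ → Word A → Word A
drop i w n = w (i + n)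

infix 4 _≈[_]_
_≈[_]_ : Word A → ℕ → Word A → Set
w ≈[ n ] v = ∀ m → m < n → w m ≡ v m

≈-sym : ∀ {w v : Word A} {n} → w ≈[ n ] v → v ≈[ n ] w
≈-sym e m m<n = sym (e m m<n)

≈-trans : ∀ {w v u : Word A} {n} → w ≈[ n ] v → v ≈[ n ] u → w ≈[ n ] u
≈-trans e f m m<n = trans (e m m<n) (f m m<n)

≈-restrict : ∀ {w v : Word A} {m n} → m ≤ n → w ≈[ n ] v → w ≈[ m ] v
≈-restrict m≤n e i i<m = e i (<-≤-trans i<m m≤n)

-- The coding `E a` and its block structure

-- R a is only ever reached through the identity L a (s) = a · R a (s).
E : Fin k → Word (Fin k) → Word (Fin k)
E a s = extend (μ (L a)) s

blockLength : Fin k → Fin k → ℕ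
blockLength a b = List⁺.length (μ (L a) b)

-- The position in E a s of the block coming from s n.
pos : Fin k → Word (Fin k) → ℕ → ℕ
pos a s zero    = 0
pos a s (suc n) = blockLength a (s 0) + pos a (s ∘ suc) n

module _ (a : Fin k) where

  blockLength-same : ∀ {b} → b ≡ a → blockLength a b ≡ 1
  blockLength-same {b} b≡a with b ≟ a
  ... | yes _  = refl
  ... | no b≢a = ⊥-elim (b≢a b≡a)

  blockLength-other : ∀ {b} → b ≢ a → blockLength a b ≡ 2
  blockLength-other {b} b≢a with b ≟ a
  ... | yes b≡a = ⊥-elim (b≢a b≡a)
  ... | no _    = refl

  E-head : ∀ s → E a s 0 ≡ a
  E-head s with s 0 ≟ a
  ... | yes _ = refl
  ... | no _  = refl

  -- A one-letter first block is followed by the `a` that opens the next block, so index 1 shows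
  -- `s 0` in either case.
  E-second : ∀ s → E a s 1 ≡ s 0
  E-second s with s 0 ≟ a
  ... | yes s₀≡a = trans (E-head (s ∘ suc)) (sym s₀≡a)
  ... | no _     = refl

  E-last-of-block : ∀ s → E a s (length (List⁺.tail (μ (L a) (s 0)))) ≡ s 0
  E-last-of-block s with s 0 ≟ a
  ... | yes s₀≡a = sym s₀≡a
  ... | no _     = refl

  E-drop-block : ∀ s x → E a s (blockLength a (s 0) + x) ≡ E a (s ∘ suc) x
  E-drop-block s x with s 0 ≟ a
  ... | yes _ = refl
  ... | no _  = refl

  R-is-tail-of-L : ∀ s → extend (μ (R a)) s ≗ E a s ∘ suc
  R-is-tail-of-L s i with s 0 ≟ a
  R-is-tail-of-L s zero          | yes s₀≡a = sym (E-head (s ∘ suc))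
  R-is-tail-of-L s (suc i)       | yes _ = R-is-tail-of-L (s ∘ suc) i
  R-is-tail-of-L s zero          | no _  = refl
  R-is-tail-of-L s (suc zero)    | no _  = sym (E-head (s ∘ suc))
  R-is-tail-of-L s (suc (suc i)) | no _  = R-is-tail-of-L (s ∘ suc) i

  E-drop-pos : ∀ s n x → E a s (pos a s n + x) ≡ E a (drop n s) x
  E-drop-pos s zero    x = refl
  E-drop-pos s (suc n) x = begin
    E a s (blockLength a (s 0) + pos a (s ∘ suc) n + x)
      ≡⟨ cong (E a s) (+-assoc (blockLength a (s 0)) _ x) ⟩
    E a s (blockLength a (s 0) + (pos a (s ∘ suc) n + x))
      ≡⟨ E-drop-block s _ ⟩
    E a (s ∘ suc) (pos a (s ∘ suc) n + x)
      ≡⟨ E-drop-pos (s ∘ suc) n x ⟩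
    E a (drop (suc n) s) x ∎
    where open ≡-Reasoning

  pos-suc : ∀ s n → pos a s (suc n) ≡ pos a s n + blockLength a (s n)
  pos-suc s zero    = +-identityʳ _
  pos-suc s (suc n) =
    trans (cong (blockLength a (s 0) +_) (pos-suc (s ∘ suc) n))
          (sym (+-assoc (blockLength a (s 0)) _ _))

  E-pos : ∀ s n → E a s (pos a s n) ≡ a
  E-pos s zero    = E-head s
  E-pos s (suc n) = trans (E-drop-block s _) (E-pos (s ∘ suc) n)

  E-suc-pos : ∀ s n → E a s (suc (pos a s n)) ≡ s n
  E-suc-pos s zero    = E-second s
  E-suc-pos s (suc n) =
    trans (cong (E a s) (sym (+-suc (blockLength a (s 0)) _)))
          (trans (E-drop-block s _) (E-suc-pos (s ∘ suc) n))

  E-pred-pos : ∀ s n → ∃[ c ] pos a s (suc n) ≡ suc c × E a s c ≡ s n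
  E-pred-pos s zero    = _ , +-identityʳ _ , E-last-of-block s
  E-pred-pos s (suc n) =
    let c , p , q = E-pred-pos (s ∘ suc) n in
    blockLength a (s 0) + c
    , trans (cong (blockLength a (s 0) +_) p) (+-suc (blockLength a (s 0)) c)
    , trans (E-drop-block s c) q

  E-occurrence : ∀ s x → E a s x ≡ a → ∃[ n ] pos a s n ≡ x
  E-occurrence s x e with s 0 ≟ a in eq
  E-occurrence s zero          e | _        = 0 , refl
  E-occurrence s (suc x)       e | yes s₀≡a =
    let n , p = E-occurrence (s ∘ suc) x e in
    suc n , cong₂ _+_ (blockLength-same s₀≡a) p
  E-occurrence s (suc zero)    e | no s₀≢a  = ⊥-elim (s₀≢a e)
  E-occurrence s (suc (suc x)) e | no s₀≢a  =
    let n , p = E-occurrence (s ∘ suc) x e in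
    suc n , cong₂ _+_ (blockLength-other s₀≢a) p

  -- Every block begins with `a`, so any other letter sits strictly further right in the image than
  -- in `s`. This strict drop is what shortens first returns.
  E-other-letter : ∀ s x → E a s x ≢ a → ∃[ m ] m < x × s m ≡ E a s x
  E-other-letter s x e with s 0 ≟ a
  E-other-letter s zero          e | yes _ = ⊥-elim (e refl)
  E-other-letter s zero          e | no _  = ⊥-elim (e refl)
  E-other-letter s (suc x)       e | yes _ =
    let m , m<x , q = E-other-letter (s ∘ suc) x e in suc m , s≤s m<x , q
  E-other-letter s (suc zero)    e | no _  = 0 , s≤s z≤n , refl
  E-other-letter s (suc (suc x)) e | no _  =
    let m , m<x , q = E-other-letter (s ∘ suc) x e in suc m , s≤s (m<n⇒m<1+n m<x) , q

  -- The bound is inclusive because a new block opens at `pos a r n`, and its first letter is `a`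
  -- whatever follows.
  E-agree : ∀ r s n → r ≈[ n ] s → ∀ x → x ≤ pos a r n → E a r x ≡ E a s x
  E-agree r s zero    r≈s zero _ = trans (E-head r) (sym (E-head s))
  E-agree r s (suc n) r≈s x    x≤ with r 0 ≟ a | s 0 ≟ a | r≈s 0 (s≤s z≤n)
  E-agree r s (suc n) r≈s zero          x≤ | yes _    | yes _    | _ = refl
  E-agree r s (suc n) r≈s (suc x) (s≤s x≤) | yes _    | yes _    | _ =
    E-agree (r ∘ suc) (s ∘ suc) n (λ m m<n → r≈s (suc m) (s≤s m<n)) x x≤
  E-agree r s (suc n) r≈s x             x≤ | yes r₀≡a | no s₀≢a  | e = ⊥-elim (s₀≢a (trans (sym e) r₀≡a))
  E-agree r s (suc n) r≈s x             x≤ | no r₀≢a  | yes s₀≡a | e = ⊥-elim (r₀≢a (trans e s₀≡a))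
  E-agree r s (suc n) r≈s zero          x≤ | no _     | no _     | _ = refl
  E-agree r s (suc n) r≈s (suc zero)    x≤ | no _     | no _     | e = e
  E-agree r s (suc n) r≈s (suc (suc x)) (s≤s (s≤s x≤)) | no _ | no _ | _ =
    E-agree (r ∘ suc) (s ∘ suc) n (λ m m<n → r≈s (suc m) (s≤s m<n)) x x≤

  -- Thanks to the inclusive bound, index 1 is available for every positive `n` and reveals the
  -- first letter. Equal first letters have blocks of equal length, which can be removed on both
  -- sides.
  E-agree⁻ : ∀ r s n → (∀ x → x ≤ pos a r n → E a r x ≡ E a s x) → r ≈[ n ] s
  E-agree⁻ r s (suc n) e zero    _         =
    trans (sym (E-second r)) (trans (e 1 (s≤s z≤n)) (E-second s))
  E-agree⁻ r s (suc n) e (suc m) (s≤s m<n) = E-agree⁻ (r ∘ suc) (s ∘ suc) n e′ m m<n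
    where
    open ≡-Reasoning
    e′ : ∀ x → x ≤ pos a (r ∘ suc) n → E a (r ∘ suc) x ≡ E a (s ∘ suc) x
    e′ x x≤ = begin
      E a (r ∘ suc) x                  ≡⟨ E-drop-block r x ⟨
      E a r (blockLength a (r 0) + x)  ≡⟨ e _ (+-monoʳ-≤ (blockLength a (r 0)) x≤) ⟩
      E a s (blockLength a (r 0) + x)
        ≡⟨ cong (λ b → E a s (blockLength a b + x)) (E-agree⁻ r s (suc n) e 0 (s≤s z≤n)) ⟩
      E a s (blockLength a (s 0) + x)  ≡⟨ E-drop-block s x ⟩
      E a (s ∘ suc) x                  ∎

  E-cong : ∀ r s → r ≗ s → E a r ≗ E a s
  E-cong r s r≗s x = E-agree r s x (λ m _ → r≗s m) x (n≤pos r x)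
    where
    n≤pos : ∀ r n → n ≤ pos a r n
    n≤pos r zero    = z≤n
    n≤pos r (suc n) = +-mono-≤ {1} (s≤s z≤n) (n≤pos (r ∘ suc) n)

  E-injective : ∀ r s → E a r ≗ E a s → r ≗ s
  E-injective r s e n = E-agree⁻ r s (suc n) (λ x _ → e x) n ≤-refl

  -- An image closed by the `a` of the next block reads backwards as the closed image of the
  -- reversed word. The letter after a block start in `r` mirrors the last letter of a block of `s`;
  -- once these agree, the two blocks have equal length and the next pair is aligned.
  E-mirror : ∀ r s n → (∀ p q → p + q ≡ pos a s (suc n) → E a r p ≡ E a s q) →
             ∀ m l → m + l ≡ n → r m ≡ s l
  E-mirror r s n h m l m+l≡n =
    letter m l (positions m (suc l) (trans (+-suc m l) (cong suc m+l≡n)))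
    where
    open ≡-Reasoning
    letter : ∀ m l → pos a r m + pos a s (suc l) ≡ pos a s (suc n) → r m ≡ s l
    letter m l e with E-pred-pos s l
    ... | c , p , q = begin
      r m                        ≡⟨ E-suc-pos r m ⟨
      E a r (suc (pos a r m))    ≡⟨ h _ c (trans (sym (+-suc _ c)) (trans (cong (pos a r m +_) (sym p)) e)) ⟩
      E a s c                    ≡⟨ q ⟩
      s l                        ∎
    positions : ∀ m l → m + l ≡ suc n → pos a r m + pos a s l ≡ pos a s (suc n)
    positions zero    l e = cong (pos a s) e
    positions (suc m) l e = begin
      pos a r (suc m) + pos a s l
        ≡⟨ cong (_+ pos a s l) (pos-suc r m) ⟩
      pos a r m + blockLength a (r m) + pos a s l
        ≡⟨ cong (λ b → pos a r m + blockLength a b + pos a s l) (letter m l ih) ⟩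
      pos a r m + blockLength a (s l) + pos a s l
        ≡⟨ +-assoc (pos a r m) _ _ ⟩
      pos a r m + (blockLength a (s l) + pos a s l)
        ≡⟨ cong (pos a r m +_) (trans (+-comm (blockLength a (s l)) _) (sym (pos-suc s l))) ⟩
      pos a r m + pos a s (suc l)
        ≡⟨ ih ⟩
      pos a s (suc n) ∎
      where ih = positions m (suc l) (trans (+-suc m l) e)

  -- Separating letters and decoding

  Separates : Word (Fin k) → Set
  Separates w = ∀ i → w i ≢ a → w (suc i) ≡ a

  E-separated : ∀ s → Separates (E a s)
  E-separated s i e with s 0 ≟ a
  E-separated s zero          e | yes _ = ⊥-elim (e refl)
  E-separated s (suc i)       e | yes _ = E-separated (s ∘ suc) i e
  E-separated s zero          e | no _  = ⊥-elim (e refl)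
  E-separated s (suc zero)    e | no _  = E-head (s ∘ suc)
  E-separated s (suc (suc i)) e | no _  = E-separated (s ∘ suc) i e

  -- The letters following the successive occurrences of a.
  derived : Word (Fin k) → Word (Fin k)
  derived w zero    = w 1
  derived w (suc n) = derived (drop (blockLength a (w 1)) w) n

  E-derived : ∀ w → w 0 ≡ a → Separates w → w ≗ E a (derived w)
  E-derived w w₀≡a sep i with w 1 ≟ a
  E-derived w w₀≡a sep zero          | yes _    = w₀≡a
  E-derived w w₀≡a sep (suc i)       | yes w₁≡a =
    E-derived (w ∘ suc) w₁≡a (λ j → sep (suc j)) i
  E-derived w w₀≡a sep zero          | no _     = w₀≡a
  E-derived w w₀≡a sep (suc zero)    | no _     = refl
  E-derived w w₀≡a sep (suc (suc i)) | no w₁≢a  =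
    E-derived (drop 2 w) (sep 1 w₁≢a) (λ j → sep (suc (suc j))) i

-- Episturmian words in terms of positions

-- `i` and `j` are the places of the two left extensions, so the common factor starts one index
-- later.
LeftSpecialAt : Word A → ℕ → ℕ → ℕ → Set
LeftSpecialAt w n i j = drop (suc i) w ≈[ n ] drop (suc j) w × w i ≢ w j

-- A positional form of being episturmian. Reversing prefixes suffices, because a
-- window of the prefix is reversed along with it. Left special factors replace right
-- special ones so that comparing lengths means passing to prefixes.
record Episturmian′ (w : Word A) : Set where
  field
    prefix-reversed : ∀ e → ∃[ j ] (∀ p q → p + q ≡ e → w (j + p) ≡ w q)
    left-special-unique : ∀ n i j i′ j′ → LeftSpecialAt w n i j → LeftSpecialAt w n i′ j′ →
      drop (suc i) w ≈[ n ] drop (suc i′) w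

open Episturmian′

-- When a prefix longer by `N` letters is reversed, the reversal of the wanted prefix is at the end,
-- `N` letters in.
prefix-reversed-late : ∀ {w : Word A} → Episturmian′ w → ∀ e N →
  ∃[ J ] N ≤ J × (∀ p q → p + q ≡ e → w (J + p) ≡ w q)
prefix-reversed-late {w = w} ew e N with prefix-reversed ew (N + e)
... | j , h = j + N , m≤n+m N j , λ p q p+q≡e →
  trans (cong w (+-assoc j N p)) (h (N + p) q (trans (+-assoc N p q) (cong (N +_) p+q≡e)))

-- A reversal of a reversal.
prefix-recurs : ∀ {w : Word A} → Episturmian′ w → ∀ e N →
  ∃[ K ] N ≤ K × (∀ q → q ≤ e → w (K + q) ≡ w q)
prefix-recurs {w = w} ew e N with prefix-reversed-late ew e 0
... | J , _ , h with prefix-reversed-late ew (J + e) N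
... | K , N≤K , h′ = K , N≤K , λ q q≤e →
  trans (h′ q (J + (e ∸ q)) (sum q q≤e)) (h (e ∸ q) q (m∸n+n≡m q≤e))
  where
  sum : ∀ q → q ≤ e → q + (J + (e ∸ q)) ≡ J + e
  sum q q≤e = begin
    q + (J + (e ∸ q))  ≡⟨ +-comm q _ ⟩
    J + (e ∸ q) + q    ≡⟨ +-assoc J _ q ⟩
    J + (e ∸ q + q)    ≡⟨ cong (J +_) (m∸n+n≡m q≤e) ⟩
    J + e              ∎
    where open ≡-Reasoning

window-recurs : ∀ {w : Word A} → Episturmian′ w → ∀ i n N →
  ∃[ K ] N ≤ K × drop i w ≈[ n ] drop K w
window-recurs {w = w} ew i n N with prefix-recurs ew (i + n) N
... | K , N≤K , h = K + i , ≤-trans N≤K (m≤m+n K i) , λ m m<n →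
  sym (trans (cong w (+-assoc K i m)) (h (i + m) (+-monoʳ-≤ i (<⇒≤ m<n))))

-- Between factors and positions

applyUpTo-cong : ∀ {f g : Word A} n → f ≈[ n ] g → applyUpTo f n ≡ applyUpTo g n
applyUpTo-cong zero    e = refl
applyUpTo-cong (suc n) e =
  cong₂ _∷_ (e 0 (s≤s z≤n)) (applyUpTo-cong n (λ m m<n → e (suc m) (s≤s m<n)))

applyUpTo-injective : ∀ {f g : Word A} n → applyUpTo f n ≡ applyUpTo g n → f ≈[ n ] g
applyUpTo-injective (suc n) e zero    _         = ∷-injectiveˡ e
applyUpTo-injective (suc n) e (suc m) (s≤s m<n) = applyUpTo-injective n (∷-injectiveʳ e) m m<n

Episturmian′⇒Recurrent : ∀ {w : Word A} → Episturmian′ w → Recurrent w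
Episturmian′⇒Recurrent ew u (i , o) N with window-recurs ew i (length u) N
... | K , N≤K , e = K , N≤K , trans (sym (applyUpTo-cong (length u) e)) o

window-occurs : ∀ (w : Word A) i n → OccursAt (applyUpTo (drop i w) n) w i
window-occurs w i n = cong (applyUpTo (drop i w)) (length-applyUpTo (drop i w) n)

reversed-window : ∀ (f g : Word A) n → applyUpTo g n ≡ applyDownFrom f n →
  ∀ p q → p + suc q ≡ n → g p ≡ f q
reversed-window f g (suc n) e zero    .n refl = ∷-injectiveˡ e
reversed-window f g (suc n) e (suc p) q  s    = reversed-window f (g ∘ suc) n (∷-injectiveʳ e) p q (suc-injective s)

-- Reversal turns left special factors into right special ones, so uniqueness carries over from the
-- latter.
Episturmian⇒Episturmian′ : ∀ {t : Word A} → Episturmian t → Episturmian′ t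
Episturmian⇒Episturmian′ {A} {t} et = record
  { prefix-reversed     = reversed
  ; left-special-unique = unique
  }
  where
  open Episturmian et
  reversed : ∀ e → ∃[ j ] (∀ p q → p + q ≡ e → t (j + p) ≡ t q)
  reversed e with reversal-closed (applyUpTo t (suc e)) (0 , window-occurs t 0 (suc e))
  ... | j , o = j , λ p q p+q≡e →
    reversed-window t (drop j t) (suc e) down p q (trans (+-suc p q) (cong suc p+q≡e))
    where
    rev : reverse (applyUpTo t (suc e)) ≡ applyDownFrom t (suc e)
    rev = reverse-applyUpTo t (suc e)
    down : applyUpTo (drop j t) (suc e) ≡ applyDownFrom t (suc e)
    down = begin
      applyUpTo (drop j t) (suc e)
        ≡⟨ cong (applyUpTo (drop j t)) (length-applyDownFrom t (suc e)) ⟨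
      applyUpTo (drop j t) (length (applyDownFrom t (suc e)))
        ≡⟨ subst (λ u → OccursAt u t j) rev o ⟩
      applyDownFrom t (suc e) ∎
      where open ≡-Reasoning

  -- The window starts one letter before the factor, so the left extension `t i` ends up right after
  -- the reversed factor.
  mirror : ∀ n i → ∃[ I ] (∀ p q → p + q ≡ n → t (I + p) ≡ t (i + q))
  mirror n i with reversed (i + n)
  ... | I , h = I , λ p q p+q≡n → h p (i + q) (begin
    p + (i + q)  ≡⟨ +-comm p _ ⟩
    i + q + p    ≡⟨ +-assoc i q p ⟩
    i + (q + p)  ≡⟨ cong (i +_) (trans (+-comm q p) p+q≡n) ⟩
    i + n        ∎)
    where open ≡-Reasoning

  mirror-last : ∀ n i → t (proj₁ (mirror n i) + n) ≡ t i
  mirror-last n i = trans (proj₂ (mirror n i) n 0 (+-identityʳ n)) (cong t (+-identityʳ i))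

  mirror-init : ∀ n i m → (m<n : m < n) →
    t (proj₁ (mirror n i) + m) ≡ t (suc i + (n ∸ suc m))
  mirror-init n i m m<n =
    trans (proj₂ (mirror n i) m (suc (n ∸ suc m)) (trans (+-suc m _) (m+[n∸m]≡n m<n)))
          (cong t (+-suc i _))

  mirror-init⁻ : ∀ n i m → (m<n : m < n) →
    t (proj₁ (mirror n i) + (n ∸ suc m)) ≡ t (suc i + m)
  mirror-init⁻ n i m m<n =
    trans (proj₂ (mirror n i) (n ∸ suc m) (suc m) (m∸n+n≡m m<n)) (cong t (+-suc i m))

  ∸suc< : ∀ n m → m < n → n ∸ suc m < n
  ∸suc< (suc n) m _ = s≤s (m∸n≤m n m)

  right-special : ∀ n i j → LeftSpecialAt t n i j →
    RightSpecial (applyUpTo (drop (proj₁ (mirror n i)) t) n) t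
  right-special n i j (agree , differ) =
    t (I + n) , t (J + n) ,
    (λ e → differ (trans (sym (mirror-last n i)) (trans e (mirror-last n j)))) ,
    (I , subst (λ u → OccursAt u t I) (sym (applyUpTo-∷ʳ (drop I t) n)) (window-occurs t I (suc n))) ,
    (J , subst (λ u → OccursAt u t J)
           (trans (sym (applyUpTo-∷ʳ (drop J t) n)) (cong (_∷ʳ t (J + n)) (sym same)))
           (window-occurs t J (suc n)))
    where
    I = proj₁ (mirror n i)
    J = proj₁ (mirror n j)
    same : applyUpTo (drop I t) n ≡ applyUpTo (drop J t) n
    same = applyUpTo-cong n λ m m<n →
      trans (mirror-init n i m m<n)
        (trans (agree (n ∸ suc m) (∸suc< n m m<n)) (sym (mirror-init n j m m<n)))

  unique : ∀ n i j i′ j′ → LeftSpecialAt t n i j → LeftSpecialAt t n i′ j′ →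
    drop (suc i) t ≈[ n ] drop (suc i′) t
  unique n i j i′ j′ ls ls′ m m<n = begin
    t (suc i + m)             ≡⟨ mirror-init⁻ n i m m<n ⟨
    t (I + (n ∸ suc m))       ≡⟨ same (n ∸ suc m) (∸suc< n m m<n) ⟩
    t (I′ + (n ∸ suc m))      ≡⟨ mirror-init⁻ n i′ m m<n ⟩
    t (suc i′ + m)            ∎
    where
    open ≡-Reasoning
    I = proj₁ (mirror n i)
    I′ = proj₁ (mirror n i′)
    same : drop I t ≈[ n ] drop I′ t
    same = applyUpTo-injective n (right-special-unique _ _
      (trans (length-applyUpTo (drop I t) n) (sym (length-applyUpTo (drop I′ t) n)))
      (right-special n i j ls) (right-special n i′ j′ ls′))

-- Transfer of the episturmian property

WindowsOf_In_ : Word A → Word A → Set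
WindowsOf w In v = ∀ i n → ∃[ j ] drop i w ≈[ n ] drop j v

-- Serves to add a letter on the left of a word without changing its set of factors.
Episturmian′-resp : ∀ {w v : Word A} → Episturmian′ w →
  WindowsOf w In v → WindowsOf v In w → Episturmian′ v
Episturmian′-resp {A} {w} {v} ew w⊆v v⊆w = record
  { prefix-reversed     = reversed
  ; left-special-unique = unique
  }
  where
  reversed : ∀ e → ∃[ j ] (∀ p q → p + q ≡ e → v (j + p) ≡ v q)
  reversed e with v⊆w 0 (suc e)
  -- Reversing the prefix of `w` that ends with this window puts the reversed window first.
  ... | i , v≈w with prefix-reversed ew (i + e)
  ... | j , h with w⊆v j (suc e)
  ... | j′ , w≈v = j′ , λ p q p+q≡e → begin
    v (j′ + p)  ≡⟨ w≈v p (s≤s (m+n≤o⇒m≤o p (≤-reflexive p+q≡e))) ⟨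
    w (j + p)   ≡⟨ h p (i + q) (trans (sym (+-assoc p i q)) (trans (cong (_+ q) (+-comm p i))
                     (trans (+-assoc i p q) (cong (i +_) p+q≡e)))) ⟩
    w (i + q)   ≡⟨ v≈w q (s≤s (m+n≤o⇒n≤o p (≤-reflexive p+q≡e))) ⟨
    v q         ∎
    where open ≡-Reasoning

  first : ∀ {n} i j → drop i v ≈[ suc n ] drop j w → v i ≡ w j
  first i j e =
    trans (cong v (sym (+-identityʳ i))) (trans (e 0 (s≤s z≤n)) (cong w (+-identityʳ j)))

  rest : ∀ {n} i j → drop i v ≈[ suc n ] drop j w → drop (suc i) v ≈[ n ] drop (suc j) w
  rest i j e m m<n =
    trans (cong v (sym (+-suc i m))) (trans (e (suc m) (s≤s m<n)) (cong w (+-suc j m)))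

  pull : ∀ n i j → LeftSpecialAt v n i j →
    LeftSpecialAt w n (proj₁ (v⊆w i (suc n))) (proj₁ (v⊆w j (suc n)))
  pull n i j (agree , differ) with v⊆w i (suc n) | v⊆w j (suc n)
  ... | i₁ , e | j₁ , f =
    ≈-trans (≈-sym (rest i i₁ e)) (≈-trans agree (rest j j₁ f)) ,
    λ eq → differ (trans (first i i₁ e) (trans eq (sym (first j j₁ f))))

  unique : ∀ n i j i′ j′ → LeftSpecialAt v n i j → LeftSpecialAt v n i′ j′ →
    drop (suc i) v ≈[ n ] drop (suc i′) v
  unique n i j i′ j′ ls ls′ =
    ≈-trans (rest i _ (proj₂ (v⊆w i (suc n))))
      (≈-trans (left-special-unique ew n _ _ _ _ (pull n i j ls) (pull n i′ j′ ls′))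
        (≈-sym (rest i′ _ (proj₂ (v⊆w i′ (suc n))))))

-- Reversed prefixes that begin with `a` begin at a block and can be decoded. Left special windows
-- survive coding because the letter before a block start is the last letter of the previous block,
-- which is the coded letter itself.
Episturmian′-E⁻ : ∀ (a : Fin k) {w} s → Episturmian′ w → w ≗ E a s → Episturmian′ s
Episturmian′-E⁻ {k} a {w} s ew w≗Es = record
  { prefix-reversed     = reversed
  ; left-special-unique = unique
  }
  where
  at-pos : ∀ n x → w (pos a s n + x) ≡ E a (drop n s) x
  at-pos n x = trans (w≗Es _) (E-drop-pos a s n x)

  reversed : ∀ n → ∃[ j ] (∀ p q → p + q ≡ n → s (j + p) ≡ s q)
  -- A prefix ending at a block start has a reversal that begins with `a`.
  reversed n with prefix-reversed ew (pos a s (suc n))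
  ... | J , h with E-occurrence a s J w[J]≡a
    where
    w[J]≡a : E a s J ≡ a
    w[J]≡a = begin
      E a s J                  ≡⟨ w≗Es J ⟨
      w J                      ≡⟨ cong w (+-identityʳ J) ⟨
      w (J + 0)                ≡⟨ h 0 _ refl ⟩
      w (pos a s (suc n))      ≡⟨ w≗Es _ ⟩
      E a s (pos a s (suc n))  ≡⟨ E-pos a s (suc n) ⟩
      a                        ∎
      where open ≡-Reasoning
  ... | j , refl = j , E-mirror a (drop j s) s n λ p q e →
    trans (sym (at-pos j p)) (trans (h p q e) (w≗Es q))

  before : ℕ → ℕ
  before i = proj₁ (E-pred-pos a s i)

  before-letter : ∀ i → w (before i) ≡ s i
  before-letter i = trans (w≗Es _) (proj₂ (proj₂ (E-pred-pos a s i)))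

  after : ∀ i x → w (suc (before i) + x) ≡ E a (drop (suc i) s) x
  after i x = trans (cong (λ c → w (c + x)) (sym (proj₁ (proj₂ (E-pred-pos a s i))))) (at-pos (suc i) x)

  image-length : ℕ → ℕ → ℕ
  image-length n i = pos a (drop (suc i) s) n

  -- The additional letter is the `a` after the image of the window, which `E-agree⁻` needs for
  -- decoding.
  push : ∀ n i j → LeftSpecialAt s n i j →
    LeftSpecialAt w (suc (image-length n i)) (before i) (before j)
  push n i j (agree , differ) =
    (λ { x (s≤s x≤) → trans (after i x) (trans (E-agree a _ _ n agree x x≤) (sym (after j x))) }) ,
    λ eq → differ (trans (sym (before-letter i)) (trans eq (before-letter j)))

  -- The two images may a priori differ in length. Cutting the longer one keeps it left special, and
  -- agreement on the shorter length is enough to decode.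
  unique-≤ : ∀ n i j i′ j′ → image-length n i ≤ image-length n i′ →
    LeftSpecialAt s n i j → LeftSpecialAt s n i′ j′ → drop (suc i) s ≈[ n ] drop (suc i′) s
  unique-≤ n i j i′ j′ ≤ ls ls′ = E-agree⁻ a _ _ n λ x x≤ →
    trans (sym (after i x)) (trans (agree x (s≤s x≤)) (after i′ x))
    where
    agree : drop (suc (before i)) w ≈[ suc (image-length n i) ] drop (suc (before i′)) w
    agree = left-special-unique ew _ _ _ _ _ (push n i j ls)
      (≈-restrict (s≤s ≤) (proj₁ (push n i′ j′ ls′)) , proj₂ (push n i′ j′ ls′))

  unique : ∀ n i j i′ j′ → LeftSpecialAt s n i j → LeftSpecialAt s n i′ j′ →
    drop (suc i) s ≈[ n ] drop (suc i′) s
  unique n i j i′ j′ ls ls′ with ≤-total (image-length n i) (image-length n i′)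
  ... | inj₁ i≤i′ = unique-≤ n i j i′ j′ i≤i′ ls ls′
  ... | inj₂ i′≤i = ≈-sym (unique-≤ n i′ j′ i j i′≤i ls′ ls)

-- Separating letters of episturmian words

-- If adjacent letters x y both differ from `a`, reversal also gives the factor y x, so x is always
-- preceded by y and y by x. A copy of x y beyond `κ` carries this alternation back to `κ`, where
-- `a` stands.
separates : ∀ {w : Word (Fin k)} → Episturmian′ w → ∀ a κ → w κ ≡ a →
  (∀ i j → w (suc i) ≡ w (suc j) → w i ≢ w j → w (suc i) ≡ a) → Separates a w
separates {w = w} ew a κ w[κ]≡a branching i w[i]≢a with w (suc i) ≟ a
... | yes e        = e
... | no w[1+i]≢a = ⊥-elim (never-a alternates-at-κ)
  where
  unique-predecessor : ∀ i j → w (suc i) ≡ w (suc j) → w (suc i) ≢ a → w i ≡ w j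
  unique-predecessor i j e ≢a with w i ≟ w j
  ... | yes e′ = e′
  ... | no ≢   = ⊥-elim (≢a (branching i j e ≢))

  -- Two consecutive letters other than a force w to alternate between them all the
  -- way down to position 0.
  Alternates : ℕ → Set
  Alternates m = (w m ≡ w i × w (suc m) ≡ w (suc i)) ⊎ (w m ≡ w (suc i) × w (suc m) ≡ w i)

  j : ℕ
  j = proj₁ (prefix-reversed ew (suc i))

  w[j] : w j ≡ w (suc i)
  w[j] = trans (cong w (sym (+-identityʳ j))) (proj₂ (prefix-reversed ew (suc i)) 0 (suc i) refl)

  w[1+j] : w (suc j) ≡ w i
  w[1+j] = trans (cong w (+-comm 1 j)) (proj₂ (prefix-reversed ew (suc i)) 1 i refl)

  back : ∀ m → Alternates (suc m) → Alternates m
  back m (inj₁ (e , _)) =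
    inj₂ (trans (unique-predecessor m j (trans e (sym w[1+j])) (w[i]≢a ∘ trans (sym e))) w[j] , e)
  back m (inj₂ (e , _)) =
    inj₁ (unique-predecessor m i e (w[1+i]≢a ∘ trans (sym e)) , e)

  back-by : ∀ d m → Alternates (d + m) → Alternates m
  back-by zero    m alt = alt
  back-by (suc d) m alt = back-by d m (back (d + m) alt)

  alternates-at-κ : Alternates κ
  alternates-at-κ with window-recurs ew i 2 κ
  ... | K , κ≤K , e = back-by (K ∸ κ) κ (subst Alternates (sym (m∸n+n≡m κ≤K)) (inj₁
    ( trans (cong w (sym (+-identityʳ K))) (trans (sym (e 0 (s≤s z≤n))) (cong w (+-identityʳ i)))
    , trans (cong w (+-comm 1 K)) (trans (sym (e 1 (s≤s (s≤s z≤n)))) (cong w (+-comm i 1))))))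

  never-a : ¬ Alternates κ
  never-a (inj₁ (e , _)) = w[i]≢a (trans (sym e) w[κ]≡a)
  never-a (inj₂ (e , _)) = w[1+i]≢a (trans (sym e) w[κ]≡a)

-- A letter with two distinct predecessors is a left special factor of length 1, hence unique. If
-- there is none, any letter that occurs will do.
separating-letter : ExcludedMiddle 0ℓ → ∀ {w : Word (Fin k)} → Episturmian′ w → ∃[ a ] Separates a w
separating-letter em {w} ew with em {∃[ i ] ∃[ j ] w (suc i) ≡ w (suc j) × w i ≢ w j}
... | no none = w 0 , separates ew _ 0 refl λ i j e ≢ → ⊥-elim (none (i , j , e , ≢))
... | yes (i , j , e , ≢) = w (suc i) , separates ew _ (suc i) refl λ i′ j′ e′ ≢′ →
  trans (cong w (sym (+-identityʳ (suc i′))))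
    (trans (left-special-unique ew 1 i′ j′ i j (special i′ j′ e′ , ≢′) (special i j e , ≢) 0 (s≤s z≤n))
      (cong w (+-identityʳ (suc i))))
  where
  special : ∀ i j → w (suc i) ≡ w (suc j) → drop (suc i) w ≈[ 1 ] drop (suc j) w
  special i j e zero _ =
    trans (cong w (+-identityʳ (suc i))) (trans e (cong w (sym (+-identityʳ (suc j)))))
  special i j e (suc m) (s≤s ())

-- No factor is new: where a prefix of `t` recurs, the letter in front of it is `a`, since otherwise
-- separation would make the first letter of the prefix equal to `a`.
prepend-separating : ∀ {a : Fin k} {t} → Episturmian′ t → Separates a t → t 0 ≢ a →
  Episturmian′ ((a ∷ []) ⧺ t)
prepend-separating {a = a} {t} et sep t₀≢a =
  Episturmian′-resp et (λ i n → suc i , λ m _ → refl) windows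
  where
  windows : WindowsOf ((a ∷ []) ⧺ t) In t
  windows (suc i) n = i , λ m _ → refl
  -- The lower bound 1 guarantees a letter in front of the recurrence.
  windows zero    n with prefix-recurs et n 1
  ... | suc K , _ , e = K , agree
    where
    t[K]≡a : t K ≡ a
    t[K]≡a with t K ≟ a
    ... | yes e′ = e′
    ... | no ≢   = ⊥-elim (t₀≢a (trans (sym (e 0 z≤n))
                     (trans (cong t (+-identityʳ (suc K))) (sep K ≢))))
    agree : (a ∷ []) ⧺ t ≈[ n ] drop K t
    agree zero    _   = trans (sym t[K]≡a) (cong t (sym (+-identityʳ K)))
    agree (suc m) m<n = trans (sym (e m (≤-trans (n≤1+n m) (<⇒≤ m<n)))) (cong t (sym (+-suc K m)))

-- Existence by greedy desubstitution

-- Greedy x (t 0) (s 0) says that t = μ x (s) uses an L-spin whenever t allows it.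
Greedy : Spinned (Fin k) → Fin k → Fin k → Set
Greedy (L a) f g = f ≡ a
Greedy (R a) f g = f ≢ a × f ≡ g

greedy-step : ExcludedMiddle 0ℓ → ∀ (t : Word (Fin k)) → Episturmian′ t →
  ∃[ x ] ∃[ s ] Episturmian′ s × t ≗ extend (μ x) s × Greedy x (t 0) (s 0)
greedy-step em t et with separating-letter em et
... | a , sep with t 0 ≟ a
... | yes t₀≡a =
  L a , derived a t , Episturmian′-E⁻ a _ et (E-derived a t t₀≡a sep) , E-derived a t t₀≡a sep , t₀≡a
... | no t₀≢a =
  R a , s , Episturmian′-E⁻ a s (prepend-separating et sep t₀≢a) at≗Es ,
  -- Dropping the prepended `a` turns `L a` into `R a`. The final `refl` works because `s 0` is the
  -- letter after that `a`, namely `t 0`.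
  (λ i → trans (at≗Es (suc i)) (sym (R-is-tail-of-L a s i))) , t₀≢a , refl
  where
  at = (a ∷ []) ⧺ t
  s  = derived a at
  sep′ : Separates a at
  sep′ zero    ≢a = ⊥-elim (≢a refl)
  sep′ (suc i) ≢a = sep i ≢a
  at≗Es : at ≗ E a s
  at≗Es = E-derived a at refl sep′

-- R-spins pass the first letter on, so a final `L a` would force `a` to be the first letter already
-- where `R a` is applied, against greediness.
greedy-avoids : ∀ (Δ : Word (Spinned (Fin k))) (g : Word (Fin k)) →
  (∀ n → Greedy (Δ n) (g n) (g (suc n))) → AvoidsBarBlocks Δ
greedy-avoids {k} Δ g greedy a u (i , o) =
  bar-contradiction (drop i Δ 0) (∷-injectiveˡ o) (greedy-at 0)
  where
  run : ∀ Δ (g : Word (Fin k)) → (∀ n → Greedy (Δ n) (g n) (g (suc n))) → ∀ u →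
    applyUpTo Δ (length (map R u ++ L a ∷ [])) ≡ map R u ++ L a ∷ [] → g 0 ≡ a
  run Δ g h [] o with Δ 0 | h 0 | ∷-injectiveˡ o
  ... | _ | g₀≡a | refl = g₀≡a
  run Δ g h (x ∷ u) o with Δ 0 | h 0 | ∷-injectiveˡ o
  ... | _ | _ , g₀≡g₁ | refl = trans g₀≡g₁ (run (Δ ∘ suc) (g ∘ suc) (h ∘ suc) u (∷-injectiveʳ o))

  greedy-at : ∀ n → Greedy (drop i Δ n) (drop i g n) (drop i g (suc n))
  greedy-at n = subst (λ m → Greedy (Δ (i + n)) (g (i + n)) (g m)) (sym (+-suc i n)) (greedy (i + n))

  bar-contradiction : ∀ x → x ≡ R a → ¬ Greedy x (drop i g 0) (drop i g 1)
  bar-contradiction _ refl (≢a , e) =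
    ≢a (trans e (run (drop i Δ ∘ suc) (drop i g ∘ suc) (greedy-at ∘ suc) u (∷-injectiveʳ o)))

-- While R-spins are used, the first letter stays and its first return gets closer.
greedy-L-occurs : ∀ (Δ : Word (Spinned (Fin k))) (ts : ℕ → Word (Fin k)) →
  (∀ n → ts n ≗ extend (μ (Δ n)) (ts (suc n))) →
  (∀ n → Greedy (Δ n) (ts n 0) (ts (suc n) 0)) →
  ∀ bound n d → d < bound → ts n (suc d) ≡ ts n 0 → ∃[ m ] n ≤ m × ∃[ a ] Δ m ≡ L a
greedy-L-occurs Δ ts step greedy (suc bound) n d (s≤s d≤bound) return
  with Δ n in eq | step n | greedy n
... | L a | _  | _ = n , ≤-refl , a , eq
... | R a | t≗ | t₀≢a , t₀≡s₀ =
  -- The block of `s 0` has two letters, so the return lies at index `d` of the image of the rest of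
  -- `s` and comes from an earlier index `m` there.
  let m , m<d , e = E-other-letter a (s ∘ suc) d (λ e → t₀≢a (trans (sym block) e))
      M , n<M , L-at-M = greedy-L-occurs Δ ts step greedy bound (suc n) m
                           (<-≤-trans m<d d≤bound) (trans e (trans block t₀≡s₀))
  in M , <⇒≤ n<M , L-at-M
  where
  open ≡-Reasoning
  s = ts (suc n)
  block : E a (s ∘ suc) d ≡ ts n 0
  block = begin
    E a (s ∘ suc) d                  ≡⟨ E-drop-block a s d ⟨
    E a s (blockLength a (s 0) + d)  ≡⟨ cong (λ l → E a s (l + d)) (blockLength-other a (t₀≢a ∘ trans t₀≡s₀)) ⟩
    E a s (suc (suc d))              ≡⟨ R-is-tail-of-L a s (suc d) ⟨
    extend (μ (R a)) s (suc d)       ≡⟨ t≗ (suc d) ⟨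
    ts n (suc d)                     ≡⟨ return ⟩
    ts n 0                           ∎

existence : ExcludedMiddle 0ℓ → ∀ {t : Word (Fin k)} → Episturmian′ t →
  ∃[ Δ ] NormalizedDirective Δ t
existence {k} em {t} et = Δ , record
  { directs           = ts , (λ n → Episturmian′⇒Recurrent (ets n)) , (λ _ → refl) , step
  ; infinitely-many-L = infinitely-many
  ; avoids            = greedy-avoids Δ (λ n → ts n 0) greedy
  }
  where
  chain : ℕ → ∃[ w ] Episturmian′ {Fin k} w
  chain zero    = t , et
  chain (suc n) = let w , ew = chain n ; _ , s , es , _ = greedy-step em w ew in s , es

  ts : ℕ → Word (Fin k)
  ts n = proj₁ (chain n)

  ets : ∀ n → Episturmian′ (ts n)
  ets n = proj₂ (chain n)

  Δ : Word (Spinned (Fin k))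
  Δ n = proj₁ (greedy-step em (ts n) (ets n))

  step : ∀ n → ts n ≗ extend (μ (Δ n)) (ts (suc n))
  step n = proj₁ (proj₂ (proj₂ (proj₂ (greedy-step em (ts n) (ets n)))))

  greedy : ∀ n → Greedy (Δ n) (ts n 0) (ts (suc n) 0)
  greedy n = proj₂ (proj₂ (proj₂ (proj₂ (greedy-step em (ts n) (ets n)))))

  infinitely-many : InfinitelyManyL Δ
  -- The lower bound 1 makes this recurrence of the first letter a genuine return.
  infinitely-many N with prefix-recurs (ets N) 0 1
  ... | suc K , _ , e = greedy-L-occurs Δ ts step greedy (suc K) N K ≤-refl
    (trans (cong (ts N) (sym (+-identityʳ (suc K)))) (e 0 z≤n))

-- Eventual periodicity

-- This shift form, with the positive period `suc p`, passes easily to images and tails.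
EventuallyPeriodic : Word A → Set
EventuallyPeriodic w = ∃[ N ] ∃[ p ] drop (N + suc p) w ≗ drop N w

EventuallyPeriodic-resp : ∀ {w v : Word A} → w ≗ v → EventuallyPeriodic w → EventuallyPeriodic v
EventuallyPeriodic-resp w≗v (N , p , e) =
  N , p , λ i → trans (sym (w≗v _)) (trans (e i) (w≗v _))

EventuallyPeriodic-E : ∀ a (s : Word (Fin k)) → EventuallyPeriodic s → EventuallyPeriodic (E a s)
-- The new period is the length of the image of one period of `s`; the inferred witness is one less.
EventuallyPeriodic-E a s (N , p , e) = pos a s N , _ , λ i → begin
  E a s (pos a s N + pos a (drop N s) (suc p) + i)  ≡⟨ cong (λ x → E a s (x + i)) (pos-+ s N (suc p)) ⟨
  E a s (pos a s (N + suc p) + i)                   ≡⟨ E-drop-pos a s (N + suc p) i ⟩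
  E a (drop (N + suc p) s) i                        ≡⟨ E-cong a (drop (N + suc p) s) (drop N s) e i ⟩
  E a (drop N s) i                                  ≡⟨ E-drop-pos a s N i ⟨
  E a s (pos a s N + i)                             ∎
  where
  open ≡-Reasoning
  pos-+ : ∀ s m n → pos a s (m + n) ≡ pos a s m + pos a (drop m s) n
  pos-+ s zero    n = refl
  pos-+ s (suc m) n =
    trans (cong (blockLength a (s 0) +_) (pos-+ (s ∘ suc) m n)) (sym (+-assoc (blockLength a (s 0)) _ _))

EventuallyPeriodic-tail : ∀ (w : Word A) → EventuallyPeriodic w → EventuallyPeriodic (w ∘ suc)
EventuallyPeriodic-tail w (N , p , e) = N , p , λ i →
  trans (cong w (sym (+-suc (N + suc p) i))) (trans (e (suc i)) (cong w (+-suc N i)))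

EventuallyPeriodic-μ : ∀ x (s : Word (Fin k)) → EventuallyPeriodic s →
  EventuallyPeriodic (extend (μ x) s)
EventuallyPeriodic-μ (L a) s ep = EventuallyPeriodic-E a s ep
EventuallyPeriodic-μ (R a) s ep = EventuallyPeriodic-resp (sym ∘ R-is-tail-of-L a s)
  (EventuallyPeriodic-tail (E a s) (EventuallyPeriodic-E a s ep))

EventuallyPeriodic⇒UltimatelyPeriodic : ∀ {w : Word A} → EventuallyPeriodic w → UltimatelyPeriodic w
EventuallyPeriodic⇒UltimatelyPeriodic {A} {w} (N , p , e) =
  applyUpTo w N , f 0 ∷ period , split w N periodic
  where
  f : Word A
  f = drop N w

  period : List A
  period = applyUpTo (f ∘ suc) p

  split : ∀ (w : Word A) N {v} → drop N w ≗ v → w ≗ applyUpTo w N ⧺ v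
  split w zero    e i       = e i
  split w (suc N) e zero    = refl
  split w (suc N) e (suc i) = split (w ∘ suc) N e i

  -- Equal to `suc p`, but written as the modulus that `_^ω` uses.
  d : ℕ
  d = suc (length period)

  f-shift : ∀ i → f (d + i) ≡ f i
  f-shift i = begin
    w (N + (d + i))      ≡⟨ cong w (+-assoc N d i) ⟨
    w (N + d + i)        ≡⟨ cong (λ q → w (N + suc q + i)) (length-applyUpTo (f ∘ suc) p) ⟩
    w (N + suc p + i)    ≡⟨ e i ⟩
    w (N + i)            ∎
    where open ≡-Reasoning

  f-shifts : ∀ q i → f (i + q * d) ≡ f i
  f-shifts zero    i = cong f (+-identityʳ i)
  f-shifts (suc q) i = begin
    f (i + (d + q * d))  ≡⟨ cong f (+-assoc i d _) ⟨
    f (i + d + q * d)    ≡⟨ f-shifts q (i + d) ⟩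
    f (i + d)            ≡⟨ cong f (+-comm i d) ⟩
    f (d + i)            ≡⟨ f-shift i ⟩
    f i                  ∎
    where open ≡-Reasoning

  lookup-period : ∀ i → lookup (f 0 ∷ period) i ≡ f (toℕ i)
  lookup-period = lookup-applyUpTo f (suc p)

  periodic : f ≗ (f 0 ∷ period) ^ω
  periodic n = begin
    f n                             ≡⟨ cong f (m≡m%n+[m/n]*n n d) ⟩
    f (n % d + (n / d) * d)         ≡⟨ f-shifts (n / d) (n % d) ⟩
    f (n % d)                       ≡⟨ cong f (toℕ-fromℕ< (m%n<n n d)) ⟨
    f (toℕ (n mod d))               ≡⟨ lookup-period (n mod d) ⟨
    lookup (f 0 ∷ period) (n mod d) ∎
    where open ≡-Reasoning

-- Uniqueness for aperiodic words

Separates-resp : ∀ {a : Fin k} {w v} → w ≗ v → Separates a w → Separates a v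
Separates-resp w≗v sep i ≢a = trans (sym (w≗v (suc i))) (sep i (≢a ∘ trans (sym (w≗v i))))

-- A letter different from both would have both as its successor, so `a` and `b` alternate from the
-- start, with period 2.
two-separating-letters : ∀ {a b : Fin k} {w} → Separates a w → Separates b w → a ≢ b →
  EventuallyPeriodic w
two-separating-letters {a = a} {b} {w} sep-a sep-b a≢b = 0 , 1 , two-periodic
  where
  after-a : ∀ i → w i ≡ a → w (suc i) ≡ b
  after-a i e = sep-b i (a≢b ∘ trans (sym e))
  after-b : ∀ i → w i ≡ b → w (suc i) ≡ a
  after-b i e = sep-a i (λ e′ → a≢b (trans (sym e′) e))
  two-periodic : ∀ i → w (2 + i) ≡ w i
  two-periodic i with w i ≟ a | w i ≟ b
  ... | yes e | _     = trans (after-b (suc i) (after-a i e)) (sym e)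
  ... | no _  | yes e = trans (after-a (suc i) (after-b i e)) (sym e)
  ... | no ≢a | no ≢b = ⊥-elim (a≢b (trans (sym (sep-a i ≢a)) (sep-b i ≢b)))

letter : Spinned (Fin k) → Fin k
letter (L a) = a
letter (R a) = a

extend-separated : ∀ x (s : Word (Fin k)) → Separates (letter x) (extend (μ x) s)
extend-separated (L a) s = E-separated a s
extend-separated (R a) s =
  Separates-resp {a = a} (sym ∘ R-is-tail-of-L a s) (λ i → E-separated a s (suc i))

extend-injective : ∀ x (r s : Word (Fin k)) → extend (μ x) r ≗ extend (μ x) s → r ≗ s
extend-injective (L a) r s e = E-injective a r s e
extend-injective (R a) r s e = E-injective a r s e′
  where
  e′ : E a r ≗ E a s
  e′ zero    = trans (E-head a r) (sym (E-head a s))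
  e′ (suc i) = trans (sym (R-is-tail-of-L a r i)) (trans (e i) (R-is-tail-of-L a s i))

greedy-spin-unique : ∀ x y {f g h : Fin k} → letter x ≡ letter y → Greedy x f g → Greedy y f h → x ≡ y
greedy-spin-unique (L a) (L .a) refl _        _        = refl
greedy-spin-unique (L a) (R .a) refl f≡a      (f≢a , _) = ⊥-elim (f≢a f≡a)
greedy-spin-unique (R a) (L .a) refl (f≢a , _) f≡a      = ⊥-elim (f≢a f≡a)
greedy-spin-unique (R a) (R .a) refl _        _        = refl

-- Separation determines the letter, the first letter of `t` determines the spin, and injectivity
-- determines the remaining word.
greedy-unique : ∀ x y {t r s : Word (Fin k)} → ¬ EventuallyPeriodic t →
  t ≗ extend (μ x) r → t ≗ extend (μ y) s → Greedy x (t 0) (r 0) → Greedy y (t 0) (s 0) →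
  x ≡ y × r ≗ s
greedy-unique x y {t} {r} {s} aperiodic t≗r t≗s greedy-x greedy-y =
  x≡y , next x≡y
  where
  same-letter : letter x ≡ letter y
  same-letter with letter x ≟ letter y
  ... | yes e = e
  ... | no ≢  = ⊥-elim (aperiodic (two-separating-letters
    (Separates-resp (sym ∘ t≗r) (extend-separated x r))
    (Separates-resp (sym ∘ t≗s) (extend-separated y s)) ≢))

  x≡y : x ≡ y
  x≡y = greedy-spin-unique x y same-letter greedy-x greedy-y

  next : x ≡ y → r ≗ s
  next refl = extend-injective x r s (λ i → trans (sym (t≗r i)) (t≗s i))

extend-L-head : ∀ {x} {a : Fin k} {t} s → t ≗ extend (μ x) s → x ≡ L a → t 0 ≡ a
extend-L-head {a = a} s t≗ refl = trans (t≗ 0) (E-head a s)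

extend-R-head : ∀ {x} {a : Fin k} {t} s → t ≗ extend (μ x) s → x ≡ R a → t 0 ≡ s 0
extend-R-head {a = a} s t≗ refl = trans (t≗ 0) (trans (R-is-tail-of-L a s 0) (E-second a s))

-- If an R a were used on a word starting with a, this first letter would persist until
-- the next L-spin, which would then be L a.
normalized-greedy : ∀ {Δ : Word (Spinned (Fin k))} (ts : ℕ → Word (Fin k)) →
  (∀ n → ts n ≗ extend (μ (Δ n)) (ts (suc n))) → InfinitelyManyL Δ → AvoidsBarBlocks Δ →
  ∀ n → Greedy (Δ n) (ts n 0) (ts (suc n) 0)
normalized-greedy {k} {Δ} ts step inf avoids n with Δ n in Δₙ
... | L a = extend-L-head (ts (suc n)) (step n) Δₙ
... | R a = R-not-first , R-preserves n Δₙ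
  where
  R-preserves : ∀ n {a} → Δ n ≡ R a → ts n 0 ≡ ts (suc n) 0
  R-preserves n = extend-R-head (ts (suc n)) (step n)

  cons : ∀ x u i → Δ i ≡ x → OccursAt u Δ (suc i) → OccursAt (x ∷ u) Δ i
  cons x u i e o = cong₂ _∷_ (trans (cong Δ (+-identityʳ i)) e)
    (trans (applyUpTo-cong (length u) (λ m _ → cong Δ (+-suc i m))) o)

  -- `d` is the distance to a known L-spin and bounds the search. The first L-spin met carries the
  -- persisting first letter, hence is `L a`.
  run : ∀ d i {b} → Δ (d + i) ≡ L b → ts i 0 ≡ a → ∃[ u ] OccursAt (map R u ++ L a ∷ []) Δ i
  run d       i e first with Δ i in Δᵢ
  run d       i e first | L c =
    [] , cons (L a) [] i (trans Δᵢ (cong L (trans (sym (extend-L-head (ts (suc i)) (step i) Δᵢ)) first))) refl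
  run zero    i e first | R c with trans (sym e) Δᵢ
  ... | ()
  run (suc d) i e first | R c =
    let u , o = run d (suc i) (trans (cong Δ (+-suc d i)) e) (trans (sym (R-preserves i Δᵢ)) first)
    in c ∷ u , cons (R c) _ i Δᵢ o

  R-not-first : ts n 0 ≢ a
  R-not-first first with inf (suc n)
  ... | m , n<m , b , L-at-m =
    let u , o = run (m ∸ suc n) (suc n) (trans (cong Δ (m∸n+n≡m n<m)) L-at-m)
                  (trans (sym (R-preserves n Δₙ)) first)
    in avoids a u (n , cons (R a) _ n Δₙ o)

uniqueness : ∀ {t : Word (Fin k)} → Aperiodic t → ∀ Δ Δ′ →
  NormalizedDirective Δ t → NormalizedDirective Δ′ t → Δ ≗ Δ′
uniqueness {k} {t} aperiodic Δ Δ′ nd nd′ =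
  let ts  , _ , ts₀  , step  = directs nd
      ts′ , _ , ts′₀ , step′ = directs nd′
      greedy  = normalized-greedy ts step (infinitely-many-L nd) (avoids nd)
      greedy′ = normalized-greedy ts′ step′ (infinitely-many-L nd′) (avoids nd′)
  in compare ts ts′ step step′ greedy greedy′
       (aperiodic ∘ EventuallyPeriodic⇒UltimatelyPeriodic ∘ EventuallyPeriodic-resp ts₀)
       (λ i → trans (ts₀ i) (sym (ts′₀ i)))
  where
  open NormalizedDirective
  compare : ∀ ts ts′ →
    (∀ n → ts n ≗ extend (μ (Δ n)) (ts (suc n))) →
    (∀ n → ts′ n ≗ extend (μ (Δ′ n)) (ts′ (suc n))) →
    (∀ n → Greedy (Δ n) (ts n 0) (ts (suc n) 0)) →
    (∀ n → Greedy (Δ′ n) (ts′ n 0) (ts′ (suc n) 0)) →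
    ¬ EventuallyPeriodic (ts 0) → ts 0 ≗ ts′ 0 → Δ ≗ Δ′
  compare ts ts′ step step′ greedy greedy′ aper start n =
    proj₁ (at n (words n))
    where
    -- Aperiodicity descends along the chain because each morphism preserves eventual periodicity.
    never-periodic : ∀ n → ¬ EventuallyPeriodic (ts n)
    never-periodic zero    = aper
    never-periodic (suc n) =
      never-periodic n ∘ EventuallyPeriodic-resp (sym ∘ step n) ∘ EventuallyPeriodic-μ (Δ n) (ts (suc n))

    at : ∀ n → ts n ≗ ts′ n → Δ n ≡ Δ′ n × ts (suc n) ≗ ts′ (suc n)
    at n same = greedy-unique (Δ n) (Δ′ n) (never-periodic n) (step n)
      (λ i → trans (same i) (step′ n i)) (greedy n)
      (subst (λ f → Greedy (Δ′ n) f (ts′ (suc n) 0)) (sym (same 0)) (greedy′ n))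

    words : ∀ n → ts n ≗ ts′ n
    words zero    = start
    words (suc n) = proj₂ (at n (words n))

theorem5p2 : ExcludedMiddle 0ℓ →
    (k : ℕ) (t : Word (Fin k)) → Episturmian t →
    (∃ λ (Δ : Word (Spinned (Fin k))) → NormalizedDirective Δ t)
    × (Aperiodic t → (Δ Δ′ : Word (Spinned (Fin k))) →
    NormalizedDirective Δ t → NormalizedDirective Δ′ t → Δ ≗ Δ′)
theorem5p2 em k t et = existence em (Episturmian⇒Episturmian′ et) , uniqueness
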